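{- Let $q, m$ be nonnegative integers with $0 \leqslant m \leqslant q-2$, let $i \in \{1,3\}$, and let $n = 4q+i$ and $k = 2q + 2m + i - 1$. Let $h = \frac{n-k-1}{2}$ (so $h = q - m$). If $h \mid n$, then $$rn_k(C_n) = \mathrm{LB}(n,k) + \frac{h-1}{2},$$ where $\mathrm{LB}(n,k) = \left\lceil \frac{3k+3-n}{2}\right\rceil \cdot \frac{n-1}{2}$.
   Context: $C_n$ is the cycle on vertex set $\mathbb{Z}_n$, with $u,v$ adjacent iff $u \equiv v \pm 1 \pmod n$; $d(u,v)$ is the graph distance. A radio-$k$-labeling of a graph $G$ is a function $f \colon V(G) \to \{0,1,2,\ldots\}$ with $|f(u)-f(v)| \geqslant k - d(u,v) + 1$ for all distinct $u,v$. The span of $f$ is $\max\{|f(u)-f(v)|\}$, and $rn_k(G)$ is the minimum span over radio-$k$-labelings of $G$. -}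

module Defs where

open import Data.Nat using (ℕ; _+_; _∸_; _≤_; _⊔_; ∣_-_∣)
open import Data.Fin using (Fin; toℕ)
open import Data.List using (List; foldr; map; concatMap)
open import Data.List using () renaming (allFin to allFinL)
open import Data.Product using (Σ; _×_; ∃)
open import Relation.Binary.PropositionalEquality using (_≡_)
open import Relation.Nullary using (¬_)

cycleDist : (n : ℕ) → Fin n → Fin n → ℕ
cycleDist n u v = Data.Nat._⊓_ ∣ toℕ u - toℕ v ∣ (n ∸ ∣ toℕ u - toℕ v ∣)

-- f is a radio-k-labeling of C_n:
-- |f(u) - f(v)| ≥ k - d(u,v) + 1 for all distinct u, v
-- (stated as k + 1 ≤ |f(u)-f(v)| + d(u,v), the same inequality over ℤ).
IsRadioKLabeling : (n k : ℕ) → (Fin n → ℕ) → Set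
IsRadioKLabeling n k f =
  ∀ (u v : Fin n) → ¬ (u ≡ v) → k + 1 ≤ ∣ f u - f v ∣ + cycleDist n u v

span : (n : ℕ) → (Fin n → ℕ) → ℕ
span n f = foldr _⊔_ 0
  (concatMap (λ u → map (λ v → ∣ f u - f v ∣) (allFinL n)) (allFinL n))

RadioNumberIs : (n k s : ℕ) → Set
RadioNumberIs n k s =
  (∃ λ (f : Fin n → ℕ) → IsRadioKLabeling n k f × span n f ≡ s)
  × (∀ (f : Fin n → ℕ) → IsRadioKLabeling n k f → s ≤ span n f)

{-# OPTIONS --safe #-}
module Submission where

-- Put n = h t with h and t odd, K = k + 1 = n - 2h, φ = n - 3h and N = (n - 1)/2.
--
-- Lower bound.  List the vertices by increasing label.  Adding the three radio conditions for
-- consecutive u, v, w, whose pairwise distances sum to at most n, gives f w - f u ≥ φ, with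
-- equality only if d(u, w) = h, and then u ≡ w (mod h).  Hence along every second vertex each
-- change of residue mod h costs one unit beyond φ.  These N + 1 vertices need more than h/2
-- residue classes, as a class has only t elements, so at least (h - 1)/2 units are lost.
--
-- Upper bound.  With c_j = ⌊j/t⌋ order the vertices as E_0, O_0, E_1, O_1, …, E_N, where
-- E_j = j h + c_j and O_j = E_j + (n + 1)/2 + ε_j.  While the E_j run through the residue class c
-- mod h, the O_j run through (h + 1)/2 + c.  Only when c reaches (h - 1)/2 is ε_j nonzero: it is
-- then (h - 1)/2, which moves O_j to the half of the class (h - 1)/2 that the E_j leave free.
-- The labels are φ j + c_j and φ j + c_j + (n + 1)/2 + ε_j - 2h.

open import Defs
open import Data.Nat
open import Data.Nat.Properties
open import Data.Nat.DivMod
open import Data.Nat.Divisibility using (_∣_; divides; n∣m*n; ∣-reflexive; ∣m+n∣m⇒∣n)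
open import Data.Nat.Tactic.RingSolver using (solve)
open import Data.Empty using (⊥-elim)
open import Data.Fin using (Fin; toℕ; fromℕ<; combine; zero; suc)
open import Data.Fin.Properties using (toℕ<n; toℕ-injective; fromℕ<-injective; combine-injective; injective⇒≤)
open import Data.List using (List; []; _∷_; length; lookup; concatMap; map; allFin)
open import Data.List.Properties using (foldr-forcesᵇ; foldr-preservesᵇ; length-tabulate)
open import Data.List.Membership.Propositional using (_∈_; lose)
open import Data.List.Membership.Propositional.Properties using (∈-lookup; ∈-allFin; ∈-map⁺; ∈-concatMap⁺)
open import Data.List.Relation.Binary.Permutation.Propositional using (_↭_; ↭-sym; ↭⇒↭ₛ)
open import Data.List.Relation.Binary.Permutation.Propositional.Properties using (↭-length)
open import Data.List.Relation.Binary.Permutation.Setoid.Properties using (Unique-resp-↭)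
open import Data.List.Relation.Binary.Sublist.Propositional using (_⊆_; ⊆-refl)
open import Data.List.Relation.Binary.Sublist.Propositional.Properties using (All-resp-⊆)
open import Data.List.Relation.Unary.All as All using (All)
import Data.List.Relation.Unary.All.Properties as All
open import Data.List.Relation.Unary.Any using (here; there; index)
open import Data.List.Relation.Unary.Any.Properties using (lookup-index)
open import Data.List.Relation.Unary.Linked using (Linked)
open import Data.List.Relation.Unary.Unique.Propositional using (Unique)
import Data.List.Relation.Unary.Unique.Propositional.Properties as Unique
open import Data.List.Sort using (sort-↭; sort-↗)
open import Data.Product using (_×_; _,_; ∃)
open import Data.Sum using (_⊎_; inj₁; inj₂)
open import Function using (_∋_; id)
open import Function.Definitions using (Injective)
open import Relation.Binary.Bundles using (DecTotalOrder)
import Relation.Binary.Construct.On as On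
open import Relation.Binary.Definitions using (tri<; tri≈; tri>)
open import Relation.Binary.PropositionalEquality
open import Relation.Nullary using (¬_)

-- Linear inequalities and the parameters.

-- Positivstellensatz certificate: A ≤ B because B - A = (Q - P) + s.
farkas : ∀ {A B P Q} s → P ≤ Q → A + Q + s ≡ B + P → A ≤ B
farkas {A} {B} {P} {Q} s P≤Q eq = +-cancelʳ-≤ Q A B (begin
  A + Q      ≤⟨ m≤m+n (A + Q) s ⟩
  A + Q + s  ≡⟨ eq ⟩
  B + P      ≤⟨ +-monoʳ-≤ B P≤Q ⟩
  B + Q      ∎)
  where open ≤-Reasoning

slack : ∀ {A B} s → A + s ≡ B → A ≤ B
slack {A} s refl = m≤m+n A s

-- The parameters as natural polynomials in h′ = (h - 1)/2 and the excess x = (n - 5h)/2, with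
-- s = (n + 1)/2 and b = s - 2h.  Matching on shape substitutes them, so that no truncated
-- subtraction occurs.
data Shape (h′ x : ℕ) : (h n K φ s b : ℕ) → Set where
  shape : Shape h′ x (suc (2 * h′)) (10 * h′ + 5 + 2 * x) (6 * h′ + 3 + 2 * x)
                     (4 * h′ + 2 + 2 * x) (5 * h′ + 3 + x) (h′ + 1 + x)

-- Two vertices at lifted positions U, V with labels F ≤ F′: the label gap is at least w, the
-- distance at least r, and w + r ≥ K; in the first case the labels alone are far enough apart.
data Separated (n K U F V F′ : ℕ) : Set where
  far    : K + F ≤ F′ → Separated n K U F V F′
  ahead  : ∀ w r → F + w ≤ F′ → K ≤ w + r →
           r + U ≤ V → r + V ≤ n + U → Separated n K U F V F′
  behind : ∀ w r → F + w ≤ F′ → K ≤ w + r →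
           r + V ≤ U → r + U ≤ n + V → Separated n K U F V F′

-- Separation of the places of the explicit order.

module _ {h′ x h n K φ s b : ℕ} where

  -- Two index steps raise the label by 2φ = K + h + 2x, so the labels alone suffice.
  far-ev-ev : Shape h′ x h n K φ s b → ∀ j d {c c′} → c ≤ c′ →
    Separated n K (j * h + c) (φ * j + c) ((2 + d + j) * h + c′) (φ * (2 + d + j) + c′)
  far-ev-ev shape j d {c} {c′} c≤c′ =
    far (farkas (2 * h′ + 1 + 2 * x + (4 * h′ + 2 + 2 * x) * d) c≤c′
                (solve (h′ ∷ x ∷ j ∷ d ∷ c ∷ c′ ∷ [])))

  far-ev-od : Shape h′ x h n K φ s b → ∀ j d {c c′ ε′} → c ≤ c′ →
    Separated n K (j * h + c) (φ * j + c)
                  ((2 + d + j) * h + s + (c′ + ε′)) (φ * (2 + d + j) + c′ + b + ε′)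
  far-ev-od shape j d {c} {c′} {ε′} c≤c′ =
    far (farkas (2 * h′ + 1 + 2 * x + (4 * h′ + 2 + 2 * x) * d + (h′ + 1 + x) + ε′) c≤c′
                (solve (h′ ∷ x ∷ j ∷ d ∷ c ∷ c′ ∷ ε′ ∷ [])))

  -- The tightest far case: the odd place already carries `b + ε`, which leaves 2φ - K - b - ε = h′
  -- + x - ε. This is where `ε ≤ h′` enters.
  far-od-ev : Shape h′ x h n K φ s b → ∀ j d {c c′ ε} → c ≤ c′ → ε ≤ h′ →
    Separated n K (j * h + s + (c + ε)) (φ * j + c + b + ε)
                  ((2 + d + j) * h + c′) (φ * (2 + d + j) + c′)
  far-od-ev shape j d {c} {c′} {ε} c≤c′ ε≤h′ =
    far (farkas (x + (4 * h′ + 2 + 2 * x) * d) (+-mono-≤ c≤c′ ε≤h′)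
                (solve (h′ ∷ x ∷ j ∷ d ∷ c ∷ c′ ∷ ε ∷ [])))

  far-od-od : Shape h′ x h n K φ s b → ∀ j d {c c′ ε ε′} → c ≤ c′ → ε ≤ ε′ →
    Separated n K (j * h + s + (c + ε)) (φ * j + c + b + ε)
                  ((2 + d + j) * h + s + (c′ + ε′)) (φ * (2 + d + j) + c′ + b + ε′)
  far-od-od shape j d {c} {c′} {ε} {ε′} c≤c′ ε≤ε′ =
    far (farkas (2 * h′ + 1 + 2 * x + (4 * h′ + 2 + 2 * x) * d) (+-mono-≤ c≤c′ ε≤ε′)
                (solve (h′ ∷ x ∷ j ∷ d ∷ c ∷ c′ ∷ ε ∷ ε′ ∷ [])))

  -- The label gap is at least φ and the arc at least h in both directions, and φ + h = K. The same
  -- balance gives `next-od-od`.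
  next-ev-ev : Shape h′ x h n K φ s b → ∀ j {c c′} → c ≤ c′ → c′ ≤ h′ →
    Separated n K (j * h + c) (φ * j + c) ((1 + j) * h + c′) (φ * (1 + j) + c′)
  next-ev-ev shape j {c} {c′} c≤c′ c′≤h′ =
    ahead (4 * h′ + 2 + 2 * x) (2 * h′ + 1)
      (farkas 0 c≤c′ (solve (h′ ∷ x ∷ j ∷ c ∷ c′ ∷ [])))
      (slack 0 (solve (h′ ∷ x ∷ [])))
      (farkas 0 c≤c′ (solve (h′ ∷ x ∷ j ∷ c ∷ c′ ∷ [])))
      (farkas (5 * h′ + 3 + 2 * x + c) c′≤h′ (solve (h′ ∷ x ∷ j ∷ c ∷ c′ ∷ [])))

  next-od-od : Shape h′ x h n K φ s b → ∀ j {c c′ ε ε′} → c ≤ c′ → c′ ≤ h′ → ε ≤ ε′ → ε′ ≤ h′ →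
    Separated n K (j * h + s + (c + ε)) (φ * j + c + b + ε)
                  ((1 + j) * h + s + (c′ + ε′)) (φ * (1 + j) + c′ + b + ε′)
  next-od-od shape j {c} {c′} {ε} {ε′} c≤c′ c′≤h′ ε≤ε′ ε′≤h′ =
    ahead (4 * h′ + 2 + 2 * x) (2 * h′ + 1)
      (farkas 0 (+-mono-≤ c≤c′ ε≤ε′) (solve (h′ ∷ x ∷ j ∷ c ∷ c′ ∷ ε ∷ ε′ ∷ [])))
      (slack 0 (solve (h′ ∷ x ∷ [])))
      (farkas 0 (+-mono-≤ c≤c′ ε≤ε′) (solve (h′ ∷ x ∷ j ∷ c ∷ c′ ∷ ε ∷ ε′ ∷ [])))
      (farkas (4 * h′ + 3 + 2 * x + c + ε) (+-mono-≤ c′≤h′ ε′≤h′)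
              (solve (h′ ∷ x ∷ j ∷ c ∷ c′ ∷ ε ∷ ε′ ∷ [])))

  -- As s + ε exceeds n/2, the relevant arc is the backward one, n - s - ε. The label gap is b + ε,
  -- so the sum is n - 2h = K whatever ε is.
  same-ev-od : Shape h′ x h n K φ s b → ∀ j c {ε q} → ε + q ≡ h′ →
    Separated n K (j * h + c) (φ * j + c) (j * h + s + (c + ε)) (φ * j + c + b + ε)
  same-ev-od shape j c {ε} {q} refl =
    ahead (ε + q + 1 + x + ε) (4 * (ε + q) + 2 + x + q)
      (slack 0 (solve (x ∷ j ∷ c ∷ ε ∷ q ∷ [])))
      (slack 0 (solve (x ∷ ε ∷ q ∷ [])))
      (slack (1 + 2 * ε) (solve (x ∷ j ∷ c ∷ ε ∷ q ∷ [])))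
      (slack 0 (solve (x ∷ j ∷ c ∷ ε ∷ q ∷ [])))

  -- The complements `p` = h′ - δ and `q` = h′ - ε′ turn the backward arc n - h - s - δ - ε′ into
  -- the polynomial `h′ + 1 + x + p + q`.
  next-ev-od : Shape h′ x h n K φ s b → ∀ j {c c′ δ p ε′ q} → c + δ ≡ c′ → δ + p ≡ h′ → ε′ + q ≡ h′ →
    Separated n K (j * h + c) (φ * j + c)
                  ((1 + j) * h + s + (c′ + ε′)) (φ * (1 + j) + c′ + b + ε′)
  next-ev-od shape j {c} {_} {δ} {p} {ε′} {q} refl δ+p ε′+q =
    ahead (4 * h′ + 2 + 2 * x + (h′ + 1 + x) + ε′) (h′ + 1 + x + p + q)
      (slack δ (solve (h′ ∷ x ∷ j ∷ c ∷ δ ∷ ε′ ∷ [])))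
      (slack (1 + 2 * x + ε′ + p + q) (solve (h′ ∷ x ∷ ε′ ∷ p ∷ q ∷ [])))
      (farkas (4 * h′ + 3 + 2 * δ + 2 * ε′) le (solve (h′ ∷ x ∷ j ∷ c ∷ δ ∷ ε′ ∷ p ∷ q ∷ [])))
      (farkas 0 le (solve (h′ ∷ x ∷ j ∷ c ∷ δ ∷ ε′ ∷ p ∷ q ∷ [])))
    where
    le : δ + p + (ε′ + q) ≤ h′ + h′
    le = ≤-reflexive (cong₂ _+_ δ+p ε′+q)

  -- The new even place lies s - h + ε - δ behind the odd one, and the label gap is φ - b + δ - ε.
  -- The corrections cancel, leaving exactly φ + h = K.
  next-od-ev : Shape h′ x h n K φ s b → ∀ j {c c′ δ p ε q} → c + δ ≡ c′ → δ + p ≡ h′ → ε + q ≡ h′ →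
    Separated n K (j * h + s + (c + ε)) (φ * j + c + b + ε)
                  ((1 + j) * h + c′) (φ * (1 + j) + c′)
  next-od-ev shape j {c} {_} {δ} {p} {ε} {q} refl δ+p ε+q =
    behind (2 * h′ + 1 + x + δ + q) (2 * h′ + 2 + x + ε + p)
      (farkas 0 (≤-reflexive ε+q) (solve (h′ ∷ x ∷ j ∷ c ∷ δ ∷ ε ∷ q ∷ [])))
      (farkas 0 (≤-reflexive (sym (cong₂ _+_ δ+p ε+q))) (solve (h′ ∷ x ∷ δ ∷ ε ∷ p ∷ q ∷ [])))
      (farkas 0 (≤-reflexive δ+p) (solve (h′ ∷ x ∷ j ∷ c ∷ δ ∷ ε ∷ p ∷ [])))
      (farkas (2 * h′ + 1 + 2 * δ + 2 * q)
              (≤-reflexive (cong₂ _+_ δ+p (cong₂ _+_ ε+q ε+q)))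
              (solve (h′ ∷ x ∷ j ∷ c ∷ δ ∷ ε ∷ p ∷ q ∷ [])))

-- Cycle distance from lifted positions.

cycleDist-comm : ∀ {n} (u v : Fin n) → cycleDist n u v ≡ cycleDist n v u
cycleDist-comm {n} u v = cong (λ d → d ⊓ (n ∸ d)) (∣-∣-comm (toℕ u) (toℕ v))

arc-≤-cycleDist : ∀ {n r} (u v : Fin n) → r + toℕ u ≤ toℕ v → r + toℕ v ≤ n + toℕ u →
                  r ≤ cycleDist n u v
arc-≤-cycleDist {n} {r} u v r+u≤v r+v≤n+u
  rewrite m≤n⇒∣m-n∣≡n∸m (m+n≤o⇒n≤o r r+u≤v) =
  ⊓-glb (m+n≤o⇒m≤o∸n r r+u≤v)
        (m+n≤o⇒m≤o∸n r (+-cancelʳ-≤ (toℕ u) _ _ (begin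
          r + (toℕ v ∸ toℕ u) + toℕ u    ≡⟨ +-assoc r _ _ ⟩
          r + (toℕ v ∸ toℕ u + toℕ u)    ≡⟨ cong (r +_) (m∸n+n≡m (m+n≤o⇒n≤o r r+u≤v)) ⟩
          r + toℕ v                      ≤⟨ r+v≤n+u ⟩
          n + toℕ u                      ∎)))
  where open ≤-Reasoning

-- The lifted difference lies in [r, n - r] and b - a lies strictly between -n and n, so β is α or α
-- + 1. In the second case the arc wraps past 0 and the roles of a and b swap.
reduce-arc : ∀ {n a b} r α β → a < n → b < n →
  r + (a + α * n) ≤ b + β * n → r + (b + β * n) ≤ n + (a + α * n) →
  (r + a ≤ b × r + b ≤ n + a) ⊎ (r + b ≤ a × r + a ≤ n + b)
reduce-arc {n} {a} {b} r α β a<n b<n le₁ le₂ with compare α β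
... | equal _ =
  inj₁ (farkas 0 le₁ (solve (n ∷ r ∷ a ∷ b ∷ α ∷ [])) , farkas 0 le₂ (solve (n ∷ r ∷ a ∷ b ∷ α ∷ [])))
... | less _ zero =
  inj₂ (farkas 0 le₂ (solve (n ∷ r ∷ a ∷ b ∷ α ∷ [])) , farkas 0 le₁ (solve (n ∷ r ∷ a ∷ b ∷ α ∷ [])))
... | less _ (suc k) =
  ⊥-elim (<⇒≱ a<n (farkas (r + b + k * n) le₂ (solve (n ∷ r ∷ a ∷ b ∷ α ∷ k ∷ []))))
... | greater _ k =
  ⊥-elim (<⇒≱ b<n (farkas (r + a + k * n) le₁ (solve (n ∷ r ∷ a ∷ b ∷ β ∷ k ∷ []))))

lift-≤-cycleDist : ∀ {n} r (u v : Fin n) α β →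
  r + (toℕ u + α * n) ≤ toℕ v + β * n → r + (toℕ v + β * n) ≤ n + (toℕ u + α * n) →
  r ≤ cycleDist n u v
lift-≤-cycleDist r u v α β le₁ le₂ with reduce-arc r α β (toℕ<n u) (toℕ<n v) le₁ le₂
... | inj₁ (le₃ , le₄) = arc-≤-cycleDist u v le₃ le₄
... | inj₂ (le₃ , le₄) = subst (r ≤_) (cycleDist-comm v u) (arc-≤-cycleDist v u le₃ le₄)

separated⇒radio : ∀ {n K U F V F′} (u v : Fin n) α β → U ≡ toℕ u + α * n → V ≡ toℕ v + β * n →
  Separated n K U F V F′ → K ≤ ∣ F - F′ ∣ + cycleDist n u v
separated⇒radio {n} {K} {U} {F} {V} {F′} u v α β refl refl = λ where
    (far K+F≤F′)                    → m≤n⇒m≤n+o _ (gap≥ K+F≤F′)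
    (ahead w r F+w≤F′ K≤w+r le₁ le₂)  → ≤-trans K≤w+r
      (+-mono-≤ (gap≥ (subst (_≤ F′) (+-comm F w) F+w≤F′)) (lift-≤-cycleDist r u v α β le₁ le₂))
    (behind w r F+w≤F′ K≤w+r le₁ le₂) → ≤-trans K≤w+r
      (+-mono-≤ (gap≥ (subst (_≤ F′) (+-comm F w) F+w≤F′))
                (subst (r ≤_) (cycleDist-comm v u) (lift-≤-cycleDist r v u β α le₁ le₂)))
  where
  gap≥ : ∀ {w} → w + F ≤ F′ → w ≤ ∣ F - F′ ∣
  gap≥ {w} w+F≤F′ = subst (w ≤_) (sym (m≤n⇒∣m-n∣≡n∸m (m+n≤o⇒n≤o w w+F≤F′))) (m+n≤o⇒m≤o∸n w w+F≤F′)

-- Upper bound: the explicit order and its labeling.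

-- The same parameters in terms of t′ = (t - 1)/2; agrees with Shape for x = (t′ - 2) * h.
data Frame (h′ t′ : ℕ) : (h t n s N : ℕ) → Set where
  frame : Frame h′ t′ (suc (2 * h′)) (suc (2 * t′)) (suc (2 * t′) * suc (2 * h′))
                      (suc (2 * h′) * t′ + h′ + 1) (suc (2 * h′) * t′ + h′)

data Gap (j : ℕ) : ℕ → Set where
  gap : ∀ d → Gap j (d + j)

toGap : ∀ {j l} → j ≤ l → Gap j l
toGap {j} {l} j≤l = subst (Gap j) (m∸n+n≡m j≤l) (gap (l ∸ j))

module Construction (h′ t′ : ℕ) where

  c : ℕ → ℕ
  c j = j / suc (2 * t′)

  -- For c j ≤ h′ this is h′ if c j = h′ and 0 otherwise.
  ε : ℕ → ℕ
  ε j = h′ * (c j ∸ pred h′)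

  -- The vertex v occurs at an even (E_j) or odd (O_j) place of the order, up to a multiple of n.
  data Placed (h n s N v : ℕ) : Set where
    ev : ∀ j α → j ≤ N → j * h + c j ≡ v + α * n → Placed h n s N v
    od : ∀ j α → suc j ≤ N → j * h + s + (c j + ε j) ≡ v + α * n → Placed h n s N v

  c-mono : ∀ {j l} → j ≤ l → c j ≤ c l
  c-mono = /-monoˡ-≤ (suc (2 * t′))

  ε-mono : ∀ {j l} → j ≤ l → ε j ≤ ε l
  ε-mono j≤l = *-monoʳ-≤ h′ (∸-monoˡ-≤ (pred h′) (c-mono j≤l))

  c-block : ∀ b l → l < suc (2 * t′) → c (b * suc (2 * t′) + l) ≡ b
  c-block b l l<t = begin
    (b * t + l) / t      ≡⟨ +-distrib-/-∣ˡ l (n∣m*n b) ⟩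
    b * t / t + l / t    ≡⟨ cong₂ _+_ (m*n/n≡m b t) (m<n⇒m/n≡0 l<t) ⟩
    b + 0                ≡⟨ +-identityʳ b ⟩
    b                    ∎
    where
    open ≡-Reasoning
    t = suc (2 * t′)

  -- N = h′ t + t′, so the indices up to N fill the blocks below h′ and stop halfway through block
  -- h′.
  c≤h′ : ∀ {h t n s N} → Frame h′ t′ h t n s N → ∀ j → j ≤ N → c j ≤ h′
  c≤h′ frame j j≤N = s≤s⁻¹ (m<n*o⇒m/o<n (≤-<-trans j≤N N<))
    where
    N< : suc (2 * h′) * t′ + h′ < suc h′ * suc (2 * t′)
    N< = slack t′ (solve (h′ ∷ t′ ∷ []))

  ε-top : ∀ a → a * (a ∸ pred a) ≡ a
  ε-top zero    = refl
  ε-top (suc a) = trans (cong (suc a *_) (m+n∸n≡m 1 a)) (*-identityʳ (suc a))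

  ε≤h′ : ∀ {h t n s N} → Frame h′ t′ h t n s N → ∀ j → j ≤ N → ε j ≤ h′
  ε≤h′ fr j j≤N = ≤-trans (*-monoʳ-≤ h′ (∸-monoˡ-≤ (pred h′) (c≤h′ fr j j≤N))) (≤-reflexive (ε-top h′))

  ε-low : ∀ b → b < h′ → h′ * (b ∸ pred h′) ≡ 0
  ε-low b b<h′ = trans (cong (h′ *_) (m≤n⇒m∸n≡0 (<⇒≤pred b<h′))) (*-zeroʳ h′)

  -- The blocks below h′ end before N, so each is complete at the even and at the odd places, the
  -- latter requiring an index below N.
  block-early : ∀ {h t n s N} → Frame h′ t′ h t n s N → ∀ b l → b < h′ → l < t → b * t + l < N
  block-early frame b l b<h′ l<t = begin-strict
    b * suc (2 * t′) + l              <⟨ +-monoʳ-< (b * suc (2 * t′)) l<t ⟩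
    b * suc (2 * t′) + suc (2 * t′)   ≡⟨ +-comm (b * suc (2 * t′)) _ ⟩
    suc b * suc (2 * t′)              ≤⟨ *-monoˡ-≤ (suc (2 * t′)) b<h′ ⟩
    h′ * suc (2 * t′)                 ≤⟨ slack t′ (solve (h′ ∷ t′ ∷ [])) ⟩
    suc (2 * h′) * t′ + h′            ∎
    where open ≤-Reasoning

  place-ev : ∀ {h t n s N v} → Frame h′ t′ h t n s N → ∀ b l α → l < t → b * t + l ≤ N →
    (b * t + l) * h + b ≡ v + α * n → Placed h n s N v
  place-ev {h} frame b l α l<t j≤N eq =
    ev _ α j≤N (trans (cong ((b * suc (2 * t′) + l) * h +_) (c-block b l l<t)) eq)

  place-od : ∀ {h t n s N v} → Frame h′ t′ h t n s N → ∀ b l α {e} → l < t → b * t + l < N →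
    h′ * (b ∸ pred h′) ≡ e → (b * t + l) * h + s + (b + e) ≡ v + α * n → Placed h n s N v
  place-od {h} {s = s} frame b l α l<t j<N ε≡e eq =
    od _ α j<N (trans (cong ((b * suc (2 * t′) + l) * h + s +_)
      (trans (cong (λ k → k + h′ * (k ∸ pred h′)) (c-block b l l<t)) (cong (b +_) ε≡e))) eq)

  -- With v = r + l h: residues r < h′ belong to E, residues r > h′ to O, and the middle coset
  -- r = h′ goes to E for l ≤ t′ and to O for l > t′.
  place-residue : ∀ {h t n s N} → Frame h′ t′ h t n s N → ∀ r l → r < h → l < t →
    Placed h n s N (r + l * h)
  place-residue frame r l r<h l<t with <-cmp r h′
  ... | tri< r<h′ _ _ =
    place-ev frame r l r l<t (<⇒≤ (block-early frame r l r<h′ l<t)) (solve (h′ ∷ t′ ∷ r ∷ l ∷ []))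
  ... | tri≈ _ refl _ with <-≤-connex t′ l
  ...   | inj₂ l≤t′ =
    place-ev frame h′ l h′ l<t (farkas 0 l≤t′ (solve (h′ ∷ t′ ∷ l ∷ []))) (solve (h′ ∷ t′ ∷ l ∷ []))
  -- In block h′ the offset is s + h′ + ε = s + 2h′ = (t′ + 1) h + h′, so O starts in this coset
  -- just after the last vertex taken by E.
  ...   | inj₁ t′<l with d , refl ← m≤n⇒∃[o]m+o≡n t′<l =
    place-od frame h′ d h′ (≤-<-trans (m≤n+m d (suc t′)) l<t)
      (farkas 0 l<t (solve (h′ ∷ t′ ∷ d ∷ []))) (ε-top h′) (solve (h′ ∷ t′ ∷ d ∷ []))
  place-residue frame r l r<h l<t | tri> _ _ h′<r with b , refl ← m≤n⇒∃[o]m+o≡n h′<r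
    with b<h′ ← (b < h′) ∋ farkas 0 r<h (solve (h′ ∷ b ∷ [])) with <-≤-connex l t′
  ...   | inj₂ t′≤l with d , refl ← m≤n⇒∃[o]m+o≡n t′≤l =
    let d<t = ≤-<-trans (m≤n+m d t′) l<t in
    place-od frame b d b d<t (block-early frame b d b<h′ d<t) (ε-low b b<h′)
      (solve (h′ ∷ t′ ∷ b ∷ d ∷ []))
  -- Since s = t′ h + h′ + 1, O enters its coset at l = t′. Smaller l are reached after one more
  -- turn, hence winding number `suc b`.
  ...   | inj₁ l<t′ =
    let l′<t = (l + t′ + 1 < suc (2 * t′)) ∋ farkas 0 l<t′ (solve (t′ ∷ l ∷ [])) in
    place-od frame b (l + t′ + 1) (suc b) l′<t (block-early frame b _ b<h′ l′<t) (ε-low b b<h′)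
      (solve (h′ ∷ t′ ∷ b ∷ l ∷ []))

  place : ∀ {h t n s N} → Frame h′ t′ h t n s N → ∀ v → v < n → Placed h n s N v
  place fr@frame v v<n = subst (Placed _ _ _ _) (sym (m≡m%n+[m/n]*n v (suc (2 * h′))))
    (place-residue fr (v % suc (2 * h′)) (v / suc (2 * h′)) (m%n<n v _) (m<n*o⇒m/o<n v<n))

  module _ {x h t n s N K φ b : ℕ} (sh : Shape h′ x h n K φ s b) (fr : Frame h′ t′ h t n s N) where

    label : ∀ {v} → Placed h n s N v → ℕ
    label (ev j _ _ _) = φ * j + c j
    label (od j _ _ _) = φ * j + c j + b + ε j

    -- An odd place has index below N, and its surplus `b + ε j` is less than φ, so the bound for
    -- the even places covers it.
    label-≤ : ∀ {v} (P : Placed h n s N v) → label P ≤ φ * N + h′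
    label-≤ (ev j _ j≤N _) = +-mono-≤ (*-monoʳ-≤ φ j≤N) (c≤h′ fr j j≤N)
    label-≤ (od j _ j<N _) = ≤-trans (od≤ sh (c≤h′ fr j (<⇒≤ j<N)) (ε≤h′ fr j (<⇒≤ j<N)))
      (+-monoˡ-≤ h′ (*-monoʳ-≤ φ j<N))
      where
      od≤ : ∀ {j c ε} → Shape h′ x h n K φ s b → c ≤ h′ → ε ≤ h′ → φ * j + c + b + ε ≤ φ * suc j + h′
      od≤ {j} {c} {ε} shape c≤ ε≤ = farkas (2 * h′ + 1 + x) (+-mono-≤ c≤ ε≤) (solve (h′ ∷ x ∷ j ∷ c ∷ ε ∷ []))

    separated-ev-ev : ∀ d j → suc d + j ≤ N → Separated n K
      (j * h + c j) (φ * j + c j) ((suc d + j) * h + c (suc d + j)) (φ * (suc d + j) + c (suc d + j))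
    separated-ev-ev zero    j l≤N = next-ev-ev sh j (c-mono (m≤n+m j 1)) (c≤h′ fr (suc j) l≤N)
    separated-ev-ev (suc d) j l≤N = far-ev-ev sh j d (c-mono (m≤n+m j (2 + d)))

    separated-od-od : ∀ d j → suc d + j ≤ N → Separated n K
      (j * h + s + (c j + ε j)) (φ * j + c j + b + ε j)
      ((suc d + j) * h + s + (c (suc d + j) + ε (suc d + j)))
      (φ * (suc d + j) + c (suc d + j) + b + ε (suc d + j))
    separated-od-od zero    j l≤N =
      next-od-od sh j (c-mono (m≤n+m j 1)) (c≤h′ fr (suc j) l≤N) (ε-mono (m≤n+m j 1)) (ε≤h′ fr (suc j) l≤N)
    separated-od-od (suc d) j l≤N =
      far-od-od sh j d (c-mono (m≤n+m j (2 + d))) (ε-mono (m≤n+m j (2 + d)))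

    -- Together with `rest`, supplies the complements `p` and `q` of the adjacent cases; the
    -- increment of `c` is bounded by its final value, at most h′.
    step : ∀ j → suc j ≤ N → c (suc j) ∸ c j + (h′ ∸ (c (suc j) ∸ c j)) ≡ h′
    step j j<N = m+[n∸m]≡n (≤-trans (m∸n≤m _ (c j)) (c≤h′ fr (suc j) j<N))

    rest : ∀ j → j ≤ N → ε j + (h′ ∸ ε j) ≡ h′
    rest j j≤N = m+[n∸m]≡n (ε≤h′ fr j j≤N)

    separated-ev-od : ∀ d j → d + j ≤ N → Separated n K
      (j * h + c j) (φ * j + c j)
      ((d + j) * h + s + (c (d + j) + ε (d + j))) (φ * (d + j) + c (d + j) + b + ε (d + j))
    separated-ev-od 0             j l≤N = same-ev-od sh j (c j) (rest j l≤N)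
    separated-ev-od 1             j l≤N =
      next-ev-od sh j (m+[n∸m]≡n (c-mono (m≤n+m j 1))) (step j l≤N) (rest (suc j) l≤N)
    separated-ev-od (suc (suc d)) j l≤N = far-ev-od sh j d (c-mono (m≤n+m j (2 + d)))

    separated-od-ev : ∀ d j → suc d + j ≤ N → Separated n K
      (j * h + s + (c j + ε j)) (φ * j + c j + b + ε j)
      ((suc d + j) * h + c (suc d + j)) (φ * (suc d + j) + c (suc d + j))
    separated-od-ev zero    j l≤N =
      next-od-ev sh j (m+[n∸m]≡n (c-mono (m≤n+m j 1))) (step j l≤N) (rest j (≤-trans (m≤n+m j 1) l≤N))
    separated-od-ev (suc d) j l≤N = far-od-ev sh j d (c-mono (m≤n+m j (2 + d)))
      (ε≤h′ fr j (≤-trans (m≤n+m j (2 + d)) l≤N))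

    Radio : (u v : Fin n) → Placed h n s N (toℕ u) → Placed h n s N (toℕ v) → Set
    Radio u v P Q = K ≤ ∣ label P - label Q ∣ + cycleDist n u v

    radio-sym : ∀ u v P Q → Radio u v P Q → Radio v u Q P
    radio-sym u v P Q = subst (K ≤_) (cong₂ _+_ (∣-∣-comm (label P) (label Q)) (cycleDist-comm u v))


    radio-ev-ev : ∀ u v {j l} α β p q eq₁ eq₂ → j < l → Radio u v (ev j α p eq₁) (ev l β q eq₂)
    radio-ev-ev u v {j} α β p q eq₁ eq₂ j<l with toGap j<l
    ... | gap d rewrite +-suc d j = separated⇒radio u v α β eq₁ eq₂ (separated-ev-ev d j q)

    radio-od-od : ∀ u v {j l} α β p q eq₁ eq₂ → j < l → Radio u v (od j α p eq₁) (od l β q eq₂)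
    radio-od-od u v {j} α β p q eq₁ eq₂ j<l with toGap j<l
    ... | gap d rewrite +-suc d j = separated⇒radio u v α β eq₁ eq₂ (separated-od-od d j (<⇒≤ q))

    radio-ev-od : ∀ u v {j l} α β p q eq₁ eq₂ → Radio u v (ev j α p eq₁) (od l β q eq₂)
    radio-ev-od u v {j} {l} α β p q eq₁ eq₂ with <-≤-connex l j
    -- E_j precedes O_j, so equal indices belong to this branch.
    ... | inj₂ j≤l with gap d ← toGap j≤l =
      separated⇒radio u v α β eq₁ eq₂ (separated-ev-od d j (<⇒≤ q))
    radio-ev-od u v {_} {l} α β p q eq₁ eq₂ | inj₁ l<j with toGap l<j
    ... | gap d rewrite +-suc d l =
      radio-sym v u (od l β q eq₂) (ev _ α p eq₁)
        (separated⇒radio v u β α eq₂ eq₁ (separated-od-ev d l p))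

    -- A lifted position determines its vertex mod n, so distinct vertices never share an index of
    -- the same parity kind.
    same⇒≡ : ∀ {x} (u v : Fin n) α β → x ≡ toℕ u + α * n → x ≡ toℕ v + β * n → u ≡ v
    same⇒≡ u v α β refl eq = toℕ-injective (begin
      toℕ u                        ≡⟨ m<n⇒m%n≡m (toℕ<n u) ⟨
      toℕ u % n                    ≡⟨ [m+kn]%n≡m%n (toℕ u) α n ⟨
      (toℕ u + α * n) % n          ≡⟨ cong (_% n) eq ⟩
      (toℕ v + β * n) % n          ≡⟨ [m+kn]%n≡m%n (toℕ v) β n ⟩
      toℕ v % n                    ≡⟨ m<n⇒m%n≡m (toℕ<n v) ⟩
      toℕ v                        ∎)
      where
      open ≡-Reasoning
      instance
        n≢0 : NonZero n
        n≢0 = >-nonZero (≤-<-trans z≤n (toℕ<n u))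

    radio : ∀ u v → ¬ (u ≡ v) → ∀ P Q → Radio u v P Q
    radio u v u≢v P@(ev j α p eq₁) Q@(ev l β q eq₂) with <-cmp j l
    ... | tri< j<l _ _  = radio-ev-ev u v α β p q eq₁ eq₂ j<l
    ... | tri≈ _ refl _ = ⊥-elim (u≢v (same⇒≡ u v α β eq₁ eq₂))
    ... | tri> _ _ l<j  = radio-sym v u Q P (radio-ev-ev v u β α q p eq₂ eq₁ l<j)
    radio u v u≢v P@(od j α p eq₁) Q@(od l β q eq₂) with <-cmp j l
    ... | tri< j<l _ _  = radio-od-od u v α β p q eq₁ eq₂ j<l
    ... | tri≈ _ refl _ = ⊥-elim (u≢v (same⇒≡ u v α β eq₁ eq₂))
    ... | tri> _ _ l<j  = radio-sym v u Q P (radio-od-od v u β α q p eq₂ eq₁ l<j)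
    radio u v u≢v (ev _ α p eq₁) (od _ β q eq₂) = radio-ev-od u v α β p q eq₁ eq₂
    radio u v u≢v P@(od _ α p eq₁) Q@(ev _ β q eq₂) =
      radio-sym v u Q P (radio-ev-od v u β α q p eq₂ eq₁)

    labeling : Fin n → ℕ
    labeling u = label (place fr (toℕ u) (toℕ<n u))

    labeling-radio : ∀ u v → ¬ (u ≡ v) → K ≤ ∣ labeling u - labeling v ∣ + cycleDist n u v
    labeling-radio u v u≢v = radio u v u≢v (place fr (toℕ u) (toℕ<n u)) (place fr (toℕ v) (toℕ<n v))

    labeling-≤ : ∀ u → labeling u ≤ φ * N + h′
    labeling-≤ u = label-≤ (place fr (toℕ u) (toℕ<n u))

-- Bounds for the span.

span-≤ : ∀ {n s} (f : Fin n → ℕ) → (∀ u → f u ≤ s) → span n f ≤ s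
span-≤ {n} {s} f f≤s = foldr-preservesᵇ {P = _≤ s} ⊔-lub z≤n (All.concat⁺ (All.map⁺ (All.universal
  (λ u → All.map⁺ (All.universal
    (λ v → ≤-trans (∣m-n∣≤m⊔n (f u) (f v)) (⊔-lub (f≤s u) (f≤s v))) (allFin n))) (allFin n))))

∣-∣≤span : ∀ {n} (f : Fin n → ℕ) u v → ∣ f u - f v ∣ ≤ span n f
∣-∣≤span {n} f u v = All.lookup
  (foldr-forcesᵇ {P = _≤ span n f} (λ x y ⊔≤ → m⊔n≤o⇒m≤o x y ⊔≤ , m⊔n≤o⇒n≤o x y ⊔≤) 0
    (concatMap (λ u → map (λ v → ∣ f u - f v ∣) (allFin _)) (allFin _)) ≤-refl)
  (∈-concatMap⁺ (λ u → map (λ v → ∣ f u - f v ∣) (allFin _))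
    (lose (∈-allFin u) (∈-map⁺ (λ v → ∣ f u - f v ∣) (∈-allFin v))))

-- Perimeters and the gap across three vertices.

Perimeter≤ : ∀ {n} → Fin n → Fin n → Fin n → Set
Perimeter≤ {n} u v w = cycleDist n u v + cycleDist n v w + cycleDist n w u ≤ n

-- Bounding the first two distances by the direct arcs and the third by the arc through 0 covers the
-- cycle exactly once.
perimeter-sorted : ∀ {n} (u v w : Fin n) → toℕ u ≤ toℕ v → toℕ v ≤ toℕ w → Perimeter≤ u v w
perimeter-sorted {n} u v w u≤v v≤w = ≤-trans
  (+-mono-≤ (+-mono-≤ (m⊓n≤m ∣ toℕ u - toℕ v ∣ _) (m⊓n≤m ∣ toℕ v - toℕ w ∣ _))
            (m⊓n≤n ∣ toℕ w - toℕ u ∣ _))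
  (around (toℕ u) (toℕ v) (toℕ w) u≤v v≤w (<⇒≤ (toℕ<n w)))
  where
  around : ∀ a b c → a ≤ b → b ≤ c → c ≤ n → ∣ a - b ∣ + ∣ b - c ∣ + (n ∸ ∣ c - a ∣) ≤ n
  around a b c a≤b b≤c c≤n with p , refl ← m≤n⇒∃[o]m+o≡n a≤b with q , refl ← m≤n⇒∃[o]m+o≡n b≤c
    rewrite ∣m-m+n∣≡n a p | ∣m-m+n∣≡n (a + p) q | ∣-∣-comm (a + p + q) a | +-assoc a p q
          | ∣m-m+n∣≡n a (p + q) =
    ≤-reflexive (m+[n∸m]≡n (m+n≤o⇒n≤o a c≤n))

perimeter-rotate : ∀ {n} (u v w : Fin n) → Perimeter≤ u v w → Perimeter≤ v w u
perimeter-rotate {n} u v w = subst (_≤ n) (trans (+-assoc (cycleDist n u v) _ _) (+-comm (cycleDist n u v) _))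

perimeter-reflect : ∀ {n} (u v w : Fin n) → Perimeter≤ u v w → Perimeter≤ w v u
perimeter-reflect {n} u v w
  rewrite cycleDist-comm u v | cycleDist-comm v w | cycleDist-comm w u =
  subst (_≤ n) (cong (_+ cycleDist n u w) (+-comm (cycleDist n v u) (cycleDist n w v)))

-- Rotations and reflections of the triple reduce all six orders to the sorted one.
perimeter : ∀ {n} (u v w : Fin n) → Perimeter≤ u v w
perimeter u v w with ≤-total (toℕ u) (toℕ v) | ≤-total (toℕ v) (toℕ w) | ≤-total (toℕ w) (toℕ u)
... | inj₁ u≤v | inj₁ v≤w | _        = perimeter-sorted u v w u≤v v≤w
... | inj₁ u≤v | inj₂ w≤v | inj₁ w≤u = perimeter-rotate w u v (perimeter-sorted w u v w≤u u≤v)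
... | inj₁ u≤v | inj₂ w≤v | inj₂ u≤w =
  perimeter-rotate w u v (perimeter-reflect v u w (perimeter-rotate w v u
    (perimeter-rotate u w v (perimeter-sorted u w v u≤w w≤v))))
... | inj₂ v≤u | inj₁ v≤w | inj₁ w≤u = perimeter-rotate w u v (perimeter-rotate v w u (perimeter-sorted v w u v≤w w≤u))
... | inj₂ v≤u | inj₁ v≤w | inj₂ u≤w =
  perimeter-reflect w v u (perimeter-rotate u w v (perimeter-rotate v u w (perimeter-sorted v u w v≤u u≤w)))
... | inj₂ v≤u | inj₂ w≤v | _        = perimeter-reflect w v u (perimeter-sorted w v u w≤v v≤u)

-- The three radio conditions add up to 3K ≤ 2(y₁ + y₂) + n, and 3K - n = 2φ.
φ≤gap : ∀ {n K h φ y₁ y₂ d₁ d₂ d₃} → n ≡ φ + 3 * h → K ≡ φ + h →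
  K ≤ y₁ + d₁ → K ≤ y₂ + d₂ → K ≤ y₁ + y₂ + d₃ → d₁ + d₂ + d₃ ≤ n → φ ≤ y₁ + y₂
φ≤gap {h = h} {φ} {y₁} {y₂} {d₁} {d₂} {d₃} refl refl le₁ le₂ le₃ le₄ = *-cancelˡ-≤ 2 twice
  where
  twice : 2 * φ ≤ 2 * (y₁ + y₂)
  twice = farkas 0 (+-mono-≤ (+-mono-≤ le₁ le₂) (+-mono-≤ le₃ le₄))
                 (solve (h ∷ φ ∷ y₁ ∷ y₂ ∷ d₁ ∷ d₂ ∷ d₃ ∷ []))

-- With y₁ + y₂ = φ, the first two conditions give d₁ + d₂ ≥ φ + 2h, so the perimeter leaves d₃ ≤ h;
-- the third gives d₃ ≥ h.
tight-gap : ∀ {n K h y₁ y₂ d₁ d₂ d₃} → n ≡ y₁ + y₂ + 3 * h → K ≡ y₁ + y₂ + h →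
  K ≤ y₁ + d₁ → K ≤ y₂ + d₂ → K ≤ y₁ + y₂ + d₃ → d₁ + d₂ + d₃ ≤ n → d₃ ≡ h
tight-gap {h = h} {y₁} {y₂} {d₁} {d₂} {d₃} refl refl le₁ le₂ le₃ le₄ = ≤-antisym
  (farkas 0 (+-mono-≤ (+-mono-≤ le₁ le₂) le₄) (solve (h ∷ y₁ ∷ y₂ ∷ d₁ ∷ d₂ ∷ d₃ ∷ [])))
  (+-cancelˡ-≤ (y₁ + y₂) _ _ le₃)

-- Residues modulo a divisor of n.

∣∣m-n∣⇒%≡ : ∀ m n {d} .{{_ : NonZero d}} → d ∣ ∣ m - n ∣ → m % d ≡ n % d
∣∣m-n∣⇒%≡ m n {d} d∣ with ≤-total m n
... | inj₁ m≤n with k , refl ← m≤n⇒∃[o]m+o≡n m≤n rewrite ∣m-m+n∣≡n m k with divides q refl ← d∣ =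
  sym ([m+kn]%n≡m%n m q d)
∣∣m-n∣⇒%≡ m n {d} d∣ | inj₂ n≤m
  with k , refl ← m≤n⇒∃[o]m+o≡n n≤m rewrite ∣-∣-comm (n + k) n | ∣m-m+n∣≡n n k with divides q refl ← d∣ =
  [m+kn]%n≡m%n n q d

-- The distance is δ or n - δ, and as d divides n, divisibility of either passes to δ.
∣cycleDist⇒%≡ : ∀ {n d} .{{_ : NonZero d}} (u v : Fin n) → d ∣ n → d ∣ cycleDist n u v → toℕ u % d ≡ toℕ v % d
∣cycleDist⇒%≡ {n} {d} u v d∣n d∣dist = ∣∣m-n∣⇒%≡ (toℕ u) (toℕ v) (side (⊓-sel δ (n ∸ δ)))
  where
  δ = ∣ toℕ u - toℕ v ∣
  δ≤n : δ ≤ n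
  δ≤n = ≤-trans (∣m-n∣≤m⊔n (toℕ u) (toℕ v)) (⊔-lub (<⇒≤ (toℕ<n u)) (<⇒≤ (toℕ<n v)))
  side : cycleDist n u v ≡ δ ⊎ cycleDist n u v ≡ n ∸ δ → d ∣ δ
  side (inj₁ eq) = subst (d ∣_) eq d∣dist
  side (inj₂ eq) = ∣m+n∣m⇒∣n (subst (d ∣_) (sym (m∸n+n≡m δ≤n)) d∣n) (subst (d ∣_) eq d∣dist)

-- Arithmetic of gaps and parameters.

extend-gap-tight : ∀ {φ p e a b l} → a + φ ≤ b → b + (φ * p + e) ≤ l → a + (φ * suc p + e) ≤ l
extend-gap-tight {φ} {p} {e} {a} {b} {l} le₁ le₂ =
  farkas 0 (+-mono-≤ le₁ le₂) (solve (φ ∷ p ∷ e ∷ a ∷ b ∷ l ∷ []))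

extend-gap-slack : ∀ {φ p e a b l} → a + suc φ ≤ b → b + (φ * p + e) ≤ l → a + (φ * suc p + suc e) ≤ l
extend-gap-slack {φ} {p} {e} {a} {b} {l} le₁ le₂ =
  farkas 0 (+-mono-≤ le₁ le₂) (solve (φ ∷ p ∷ e ∷ a ∷ b ∷ l ∷ []))

n≡1+2N : ∀ {h′ t′ h t n s N} → Frame h′ t′ h t n s N → n ≡ suc (2 * N)
n≡1+2N {h′} {t′} frame = solve (h′ ∷ t′ ∷ [])

-- Only h′ t = N - t′ vertices fit into h′ cosets, so N + 1 vertices need at least h′ + 1 of them.
half-cosets : ∀ {h′ t′ h t n s N e} → Frame h′ t′ h t n s N → suc N ≤ suc e * t → h′ ≤ e
half-cosets {h′} {t′} {e = e} frame le with ≤-<-connex h′ e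
... | inj₁ h′≤e = h′≤e
... | inj₂ e<h′ = ⊥-elim (1+n≰n (1≤0 (≤-trans le (*-monoˡ-≤ (suc (2 * t′)) e<h′))))
  where
  1≤0 : suc (suc (2 * h′) * t′ + h′) ≤ h′ * suc (2 * t′) → 1 ≤ 0
  1≤0 le = farkas t′ le (solve (h′ ∷ t′ ∷ []))

toShape : ∀ {h′ x n K s} → n ≡ 10 * h′ + 5 + 2 * x → K ≡ 6 * h′ + 3 + 2 * x → s ≡ 5 * h′ + 3 + x →
  Shape h′ x (suc (2 * h′)) n K (4 * h′ + 2 + 2 * x) s (h′ + 1 + x)
toShape refl refl refl = shape

shape-n : ∀ {h′ x h n K φ s b} → Shape h′ x h n K φ s b → n ≡ φ + 3 * h
shape-n {h′} {x} shape = solve (h′ ∷ x ∷ [])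

shape-K : ∀ {h′ x h n K φ s b} → Shape h′ x h n K φ s b → K ≡ φ + h
shape-K {h′} {x} shape = solve (h′ ∷ x ∷ [])

-- Identifies the ceiling in LB(n,k) with φ.
shape-3K : ∀ {h′ x h n K φ s b} → Shape h′ x h n K φ s b → 3 * K ≡ φ + φ + n
shape-3K {h′} {x} shape = solve (h′ ∷ x ∷ [])

-- Lower bound: every second vertex in label order.

module LowerBound where

  open import Data.List.Relation.Unary.All using ([]; _∷_)
  open import Data.List.Relation.Unary.AllPairs using (_∷_)
  open import Data.List.Relation.Unary.Linked using (_∷_)
  open import Data.List.Relation.Binary.Sublist.Propositional using (_∷_; _∷ʳ_)

  lookup-injective : ∀ {A : Set} {xs : List A} → Unique xs → Injective _≡_ _≡_ (lookup xs)
  lookup-injective (x∉ ∷ xs!) {zero}  {zero}  eq = refl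
  lookup-injective (x∉ ∷ xs!) {zero}  {suc j} eq = ⊥-elim (All.lookup x∉ (∈-lookup j) eq)
  lookup-injective (x∉ ∷ xs!) {suc i} {zero}  eq = ⊥-elim (All.lookup x∉ (∈-lookup i) (sym eq))
  lookup-injective (x∉ ∷ xs!) {suc i} {suc j} eq = cong suc (lookup-injective xs! eq)

  -- A vertex is determined by its residue and its quotient by d. Coding it as the position of the
  -- residue in `D` with a quotient below t is injective.
  length-≤-residues : ∀ {n t d} .{{_ : NonZero d}} {E : List (Fin n)} {D : List ℕ} → n ≡ t * d →
    Unique E → All (λ u → toℕ u % d ∈ D) E → length E ≤ length D * t
  length-≤-residues {n} {t} {d} {E} {D} refl E! E⊆D = injective⇒≤ {f = code} code-injective
    where
    res : ∀ i → toℕ (lookup E i) % d ∈ D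
    res i = All.lookup E⊆D (∈-lookup i)
    quot< : ∀ i → toℕ (lookup E i) / d < t
    quot< i = m<n*o⇒m/o<n (toℕ<n (lookup E i))
    code : Fin (length E) → Fin (length D * t)
    code i = combine (index (res i)) (fromℕ< (quot< i))
    code-injective : Injective _≡_ _≡_ code
    code-injective {i} {j} eq with combine-injective (index (res i)) _ (index (res j)) _ eq
    ... | eq₁ , eq₂ = lookup-injective E! (toℕ-injective (begin
      toℕ (lookup E i)                                     ≡⟨ m≡m%n+[m/n]*n _ d ⟩
      toℕ (lookup E i) % d + toℕ (lookup E i) / d * d      ≡⟨ cong₂ (λ r q → r + q * d) same-residue (fromℕ<-injective _ _ (quot< i) (quot< j) eq₂) ⟩
      toℕ (lookup E j) % d + toℕ (lookup E j) / d * d      ≡⟨ m≡m%n+[m/n]*n _ d ⟨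
      toℕ (lookup E j)                                     ∎))
      where
      open ≡-Reasoning
      same-residue : toℕ (lookup E i) % d ≡ toℕ (lookup E j) % d
      same-residue = trans (lookup-index (res i)) (trans (cong (lookup D) eq₁) (sym (lookup-index (res j))))

  module _ {n K h φ : ℕ} .{{_ : NonZero h}} (n≡ : n ≡ φ + 3 * h) (K≡ : K ≡ φ + h) (h∣n : h ∣ n)
    (f : Fin n → ℕ) (f-radio : ∀ u v → ¬ (u ≡ v) → K ≤ ∣ f u - f v ∣ + cycleDist n u v) where

    -- A gap above φ is at least φ + 1. A gap equal to φ forces distance h between the outer
    -- vertices, hence equal residues as h divides n.
    triple-gap : ∀ {u v w} → ¬ (u ≡ v) → ¬ (v ≡ w) → ¬ (u ≡ w) → f u ≤ f v → f v ≤ f w →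
      f u + suc φ ≤ f w ⊎ (f u + φ ≤ f w × toℕ u % h ≡ toℕ w % h)
    triple-gap {u} {v} {w} u≢v v≢w u≢w fu≤fv fv≤fw
      with f-radio u v u≢v | f-radio v w v≢w | f-radio u w u≢w
    ... | r₁ | r₂ | r₃
      -- Abstracting after `r₁`, `r₂`, `r₃` are bound lets the equations rewrite the labels inside
      -- them too.
      with f v | f w | m≤n⇒∃[o]m+o≡n fu≤fv | m≤n⇒∃[o]m+o≡n fv≤fw
    ... | _ | _ | y₁ , refl | y₂ , refl
      rewrite ∣m-m+n∣≡n (f u) y₁ | ∣m-m+n∣≡n (f u + y₁) y₂ | +-assoc (f u) y₁ y₂ | ∣m-m+n∣≡n (f u) (y₁ + y₂)
            | cycleDist-comm u w
      with m≤n⇒m<n∨m≡n (φ≤gap {h = h} {φ} {y₁} {y₂} n≡ K≡ r₁ r₂ r₃ (perimeter u v w))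
    ... | inj₁ φ<y = inj₁ (+-monoʳ-≤ (f u) φ<y)
    ... | inj₂ refl = inj₂ (≤-refl , sym (∣cycleDist⇒%≡ w u h∣n
      (∣-reflexive (sym (tight-gap {h = h} {y₁} {y₂} n≡ K≡ r₁ r₂ r₃ (perimeter u v w))))))

    -- evens is every second element of xs; each residue in others costs one unit beyond φ * p.
    record Alternate (p : ℕ) (x : Fin n) (xs : List (Fin n)) : Set where
      field
        {evens}  : List (Fin n)
        {others} : List ℕ
        {last}   : Fin n
        evens⊆   : evens ⊆ xs
        unique   : Unique (x ∷ evens)
        len      : length evens ≡ p
        {first}  : ℕ
        first∈   : toℕ x % h ∈ first ∷ others
        residues : All (λ u → toℕ u % h ∈ first ∷ others) evens
        gaps     : f x + (φ * p + length others) ≤ f last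

    -- The list is consumed two vertices at a time. A tight step keeps the residue list; a slack
    -- step puts the residue of `x` in front, so the list grows exactly when a unit is charged.
    alternate : ∀ p x xs → length xs ≡ 2 * p → Linked (λ u v → f u ≤ f v) (x ∷ xs) → Unique (x ∷ xs) →
      Alternate p x xs
    alternate zero x [] eq sorted x∷xs! = record
      { others = [] ; evens⊆ = ⊆-refl ; unique = x∷xs! ; len = refl ; first∈ = here refl ; residues = []
      ; gaps = ≤-reflexive (trans (cong (f x +_) (trans (+-identityʳ _) (*-zeroʳ φ))) (+-identityʳ (f x))) }
    alternate (suc p) x [] ()
    alternate (suc p) x (y ∷ []) eq with () ← trans (suc-injective eq) (+-suc p (p + 0))
    alternate (suc p) x (y ∷ z ∷ xs) eq (x≤y ∷ y≤z ∷ sorted) ((x≢y ∷ x≢z ∷ x∉xs) ∷ ((y≢z ∷ _) ∷ zxs!))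
      with alternate p z xs (suc-injective (trans (suc-injective eq) (+-suc p (p + 0)))) sorted zxs!
         | triple-gap x≢y y≢z x≢z x≤y y≤z
    ... | record { evens⊆ = evens⊆ ; unique = unique ; len = len ; first∈ = first∈ ; residues = residues ; gaps = gaps }
        | inj₂ (x+φ≤z , x≡z) = record
      { evens⊆ = y ∷ʳ refl ∷ evens⊆ ; unique = (x≢z ∷ All-resp-⊆ evens⊆ x∉xs) ∷ unique ; len = cong suc len
      ; first∈ = subst (_∈ _) (sym x≡z) first∈ ; residues = first∈ ∷ residues
      ; gaps = extend-gap-tight {φ} {p} x+φ≤z gaps }
    ... | record { evens⊆ = evens⊆ ; unique = unique ; len = len ; first∈ = first∈ ; residues = residues ; gaps = gaps }
        | inj₁ x+φ<z = record
      { evens⊆ = y ∷ʳ refl ∷ evens⊆ ; unique = (x≢z ∷ All-resp-⊆ evens⊆ x∉xs) ∷ unique ; len = cong suc len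
      ; first∈ = here refl ; residues = there first∈ ∷ All.map there residues
      ; gaps = extend-gap-slack {φ} {p} x+φ<z gaps }

  module _ {h′ t′ h t n s N K φ : ℕ} .{{_ : NonZero h}} (fr : Frame h′ t′ h t n s N)
    (n≡ : n ≡ φ + 3 * h) (K≡ : K ≡ φ + h)
    (f : Fin n → ℕ) (f-radio : ∀ u v → ¬ (u ≡ v) → K ≤ ∣ f u - f v ∣ + cycleDist n u v) where

    n≡t*h : ∀ {h t n s N} → Frame h′ t′ h t n s N → n ≡ t * h
    n≡t*h frame = refl

    label-order : DecTotalOrder _ _ _
    label-order = On.decTotalOrder ≤-decTotalOrder f

    sorted⇒≤-span : ∀ xs → xs ↭ allFin n → Linked (λ u v → f u ≤ f v) xs → φ * N + h′ ≤ span n f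
    sorted⇒≤-span xs perm sorted
      with trans (↭-length perm) (trans (length-tabulate (id)) (n≡1+2N fr))
         | Unique-resp-↭ (setoid (Fin n)) (↭⇒↭ₛ (↭-sym perm)) (Unique.allFin⁺ n)
    sorted⇒≤-span (x ∷ xs) perm sorted | len | unique = begin
      φ * N + h′                 ≤⟨ +-monoʳ-≤ (φ * N) h′≤others ⟩
      φ * N + length others      ≤⟨ m+n≤o⇒m≤o∸n _ (subst (_≤ f last) (+-comm (f x) _) gaps) ⟩
      f last ∸ f x               ≡⟨ m≤n⇒∣m-n∣≡n∸m (m+n≤o⇒m≤o (f x) gaps) ⟨
      ∣ f x - f last ∣           ≤⟨ ∣-∣≤span f x last ⟩
      span n f                   ∎
      where
      open ≤-Reasoning
      open Alternate (alternate n≡ K≡ (divides t (n≡t*h fr)) f f-radio N x xs (suc-injective len) sorted unique)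
        renaming (unique to evens-unique; len to evens-len)
      h′≤others : h′ ≤ length others
      -- `x ∷ evens` has N + 1 vertices, all with residues in `first ∷ others`, so `half-cosets`
      -- applies with e = `length others`.
      h′≤others = half-cosets fr (subst (_≤ suc (length others) * t) (cong suc evens-len)
        (length-≤-residues (n≡t*h fr) evens-unique (first∈ ∷ residues)))

    ≤-span : φ * N + h′ ≤ span n f
    ≤-span = sorted⇒≤-span _ (sort-↭ label-order (allFin n)) (sort-↗ label-order (allFin n))

-- The radio number in the original parameters.

radioNumber : ∀ {h′ x t′ h t n s N k φ b} → Shape h′ x h n (k + 1) φ s b → Frame h′ t′ h t n s N →
  RadioNumberIs n k (φ * N + h′)
radioNumber {h′} {t′ = t′} sh fr@frame =
    (labeling sh fr , labeling-radio sh fr ,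
      -- The span is exact because the lower bound also applies to the constructed labeling.
      ≤-antisym (span-≤ (labeling sh fr) (labeling-≤ sh fr)) (lower (labeling sh fr) (labeling-radio sh fr)))
  , lower
  where
  open Construction h′ t′
  lower : ∀ f → IsRadioKLabeling _ _ f → _
  lower f f-radio = LowerBound.≤-span fr (shape-n sh) (shape-K sh) f f-radio

⌊2n/2⌋≡n : ∀ n → ⌊ 2 * n /2⌋ ≡ n
⌊2n/2⌋≡n n = sym (trans (n≡⌊n+n/2⌋ n) (cong (λ m → ⌊ n + m /2⌋) (sym (+-identityʳ n))))

radioNumber-odd : ∀ h′ τ {n k} → n ≡ suc (2 * (2 + τ)) * suc (2 * h′) → n ≡ k + suc (2 * suc (2 * h′)) →
  RadioNumberIs n k (⌈ 3 * k + 3 ∸ n /2⌉ * ⌊ n ∸ 1 /2⌋ + h′)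
radioNumber-odd h′ τ {n} {k} n≡t*h n≡ = subst (RadioNumberIs n k) (cong (_+ h′) (sym (cong₂ _*_ φ-eq N-eq)))
    (radioNumber sh fr)
  where
  -- Here t = 5 + 2τ, so the excess (n - 5h)/2 is τ h.
  x = τ * suc (2 * h′)
  φ = 4 * h′ + 2 + 2 * x
  N = suc (2 * h′) * (2 + τ) + h′
  t*h-eq : suc (2 * (2 + τ)) * suc (2 * h′) ≡ 6 * h′ + 3 + 2 * (τ * suc (2 * h′)) + 2 * suc (2 * h′)
  t*h-eq = solve (h′ ∷ τ ∷ [])
  K-eq : k + 1 ≡ 6 * h′ + 3 + 2 * (τ * suc (2 * h′))
  K-eq = +-cancelʳ-≡ (2 * suc (2 * h′)) _ _ (trans (+-assoc k 1 _) (trans (sym n≡) (trans n≡t*h t*h-eq)))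
  s-eq : suc (2 * h′) * (2 + τ) + h′ + 1 ≡ 5 * h′ + 3 + τ * suc (2 * h′)
  s-eq = solve (h′ ∷ τ ∷ [])
  n-eq : suc (2 * (2 + τ)) * suc (2 * h′) ≡ 10 * h′ + 5 + 2 * (τ * suc (2 * h′))
  n-eq = solve (h′ ∷ τ ∷ [])
  fr : Frame h′ (2 + τ) (suc (2 * h′)) (suc (2 * (2 + τ))) n (suc (2 * h′) * (2 + τ) + h′ + 1) N
  fr rewrite n≡t*h = frame
  sh : Shape h′ x (suc (2 * h′)) n (k + 1) φ (suc (2 * h′) * (2 + τ) + h′ + 1) (h′ + 1 + x)
  sh = toShape (trans n≡t*h n-eq) K-eq s-eq
  3K : 3 * k + 3 ≡ φ + φ + n
  3K = trans (sym (*-distribˡ-+ 3 k 1)) (shape-3K sh)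
  φ-eq : ⌈ 3 * k + 3 ∸ n /2⌉ ≡ φ
  φ-eq = trans (cong (λ a → ⌈ a ∸ n /2⌉) 3K) (trans (cong ⌈_/2⌉ (m+n∸n≡m (φ + φ) n)) (sym (n≡⌈n+n/2⌉ φ)))
  N-eq : ⌊ n ∸ 1 /2⌋ ≡ N
  N-eq = trans (cong (λ a → ⌊ a ∸ 1 /2⌋) (n≡1+2N fr)) (⌊2n/2⌋≡n N)

even-or-odd : ∀ n → ∃ λ m → n ≡ 2 * m ⊎ n ≡ suc (2 * m)
even-or-odd zero = 0 , inj₁ refl
even-or-odd (suc n) with even-or-odd n
... | m , inj₁ refl = m , inj₂ refl
... | m , inj₂ refl = suc m , inj₁ (sym (*-suc 2 m))

odd-factorʳ : ∀ a b c → a * b ≡ suc (2 * c) → ∃ λ m → b ≡ suc (2 * m)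
odd-factorʳ a b c eq with even-or-odd b
... | m , inj₁ refl = ⊥-elim (even≢odd (a * m) c (trans ((2 * (a * m) ≡ a * (2 * m)) ∋ solve (a ∷ m ∷ [])) eq))
... | m , inj₂ eq′  = m , eq′

5≤2n+1⇒2≤n : ∀ n → 5 ≤ suc (2 * n) → 2 ≤ n
5≤2n+1⇒2≤n n 5≤ = *-cancelˡ-≤ 2 (s≤s⁻¹ 5≤)

-- As n = t h is odd, so are t and h; 4h < n then gives t ≥ 5, that is t′ = 2 + τ.
radioNumber-∣ : ∀ n k h M → n ≡ suc (2 * M) → n ≡ k + suc (2 * h) → 4 * h < n → h ∣ n →
  RadioNumberIs n k (⌈ 3 * k + 3 ∸ n /2⌉ * ⌊ n ∸ 1 /2⌋ + ⌊ h ∸ 1 /2⌋)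
radioNumber-∣ n k h M odd n≡ 4h<n (divides t n≡t*h)
  with odd-factorʳ t h M (trans (sym n≡t*h) odd)
     | odd-factorʳ h t M (trans (*-comm h t) (trans (sym n≡t*h) odd))
... | h′ , refl | t′ , refl
  with m≤n⇒∃[o]m+o≡n (5≤2n+1⇒2≤n t′
         (*-cancelʳ-< (suc (2 * h′)) 4 (suc (2 * t′)) (subst (4 * suc (2 * h′) <_) n≡t*h 4h<n)))
... | τ , refl = subst (λ e → RadioNumberIs n k (⌈ 3 * k + 3 ∸ n /2⌉ * ⌊ n ∸ 1 /2⌋ + e))
  (sym (⌊2n/2⌋≡n h′)) (radioNumber-odd h′ τ n≡t*h n≡)

radioNumber-half : ∀ n k h M → n ≡ suc (2 * M) → n ≡ k + suc (2 * h) → 4 * h < n →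
  ⌊ n ∸ k ∸ 1 /2⌋ ∣ n →
  RadioNumberIs n k (⌈ 3 * k + 3 ∸ n /2⌉ * ⌊ n ∸ 1 /2⌋ + ⌊ ⌊ n ∸ k ∸ 1 /2⌋ ∸ 1 /2⌋)
radioNumber-half n k h M odd n≡ 4h<n = subst
  (λ a → a ∣ n → RadioNumberIs n k (⌈ 3 * k + 3 ∸ n /2⌉ * ⌊ n ∸ 1 /2⌋ + ⌊ a ∸ 1 /2⌋))
  (sym h-eq) (radioNumber-∣ n k h M odd n≡ 4h<n)
  where
  h-eq : ⌊ n ∸ k ∸ 1 /2⌋ ≡ h
  h-eq = begin
    ⌊ n ∸ k ∸ 1 /2⌋                       ≡⟨ cong (λ a → ⌊ a ∸ k ∸ 1 /2⌋) n≡ ⟩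
    ⌊ k + suc (2 * h) ∸ k ∸ 1 /2⌋         ≡⟨ cong (λ a → ⌊ a ∸ 1 /2⌋) (m+n∸m≡n k (suc (2 * h))) ⟩
    ⌊ 2 * h /2⌋                           ≡⟨ ⌊2n/2⌋≡n h ⟩
    h                                     ∎
    where open ≡-Reasoning

theorem4p6 : (q m i : ℕ) → m + 2 ≤ q → (i ≡ 1 ⊎ i ≡ 3) →
  let n = 4 * q + i
      k = 2 * q + 2 * m + i ∸ 1
      h = ⌊ n ∸ k ∸ 1 /2⌋
  in h ∣ n →
     RadioNumberIs n k (⌈ 3 * k + 3 ∸ n /2⌉ * ⌊ n ∸ 1 /2⌋ + ⌊ h ∸ 1 /2⌋)
theorem4p6 q m i m+2≤q i≡ with m≤n⇒∃[o]m+o≡n m+2≤q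
theorem4p6 _ m _ _ (inj₁ refl) | y , refl =
  -- With q = m + 2 + y, h = q - m is `2 + y`, and M = (n - 1)/2 is 2q here and 2q + 1 for i = 3.
  radioNumber-half (4 * (m + 2 + y) + 1) (2 * (m + 2 + y) + 2 * m + 1 ∸ 1) (2 + y) (2 * (m + 2 + y)) (solve (m ∷ y ∷ []))
    (subst (λ k → 4 * (m + 2 + y) + 1 ≡ k + suc (2 * (2 + y))) (sym (m+n∸n≡m _ 1)) n≡)
    (slack (4 * m) (solve (m ∷ y ∷ [])))
  where
  n≡ : 4 * (m + 2 + y) + 1 ≡ 2 * (m + 2 + y) + 2 * m + suc (2 * (2 + y))
  n≡ = solve (m ∷ y ∷ [])
theorem4p6 _ m _ _ (inj₂ refl) | y , refl =
  radioNumber-half (4 * (m + 2 + y) + 3) (2 * (m + 2 + y) + 2 * m + 3 ∸ 1) (2 + y) (2 * (m + 2 + y) + 1) (solve (m ∷ y ∷ []))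
    (subst (λ k → 4 * (m + 2 + y) + 3 ≡ k + suc (2 * (2 + y))) (sym (+-∸-assoc (2 * (m + 2 + y) + 2 * m) {3} {1} (s≤s z≤n))) n≡)
    (slack (4 * m + 2) (solve (m ∷ y ∷ [])))
  where
  n≡ : 4 * (m + 2 + y) + 3 ≡ 2 * (m + 2 + y) + 2 * m + 2 + suc (2 * (2 + y))
  n≡ = solve (m ∷ y ∷ [])
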